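{- Let $X$ be a finite set. An operation $\ast\in\mathcal{M}(X)$ is a regular element of $\mathcal{M}(X)$ if and only if $cim(T_\ast)=diag(T_\ast)$.
   Context: $\mathcal{M}(X)=X^{X\times X}$ is the set of all binary operations on $X$, a monoid under $\triangleright$ defined by $a(\circ\triangleright\ast)b=(a\circ b)\ast(b\circ a)$ for all $a,b\in X$. An element $\ast\in\mathcal{M}(X)$ is regular if there is $\circ\in\mathcal{M}(X)$ with $\ast\triangleright\circ\triangleright\ast=\ast$. The pairmorph transformation of $\ast$ is $T_\ast:X\times X\to X\times X$, $T_\ast(a,b)=(a\ast b,b\ast a)$. With $\Delta(X)=\{(x,x):x\in X\}$: $im(T_\ast)=T_\ast(X\times X)$, $diag(T_\ast)=T_\ast(\Delta(X))$, and $cim(T_\ast)=im(T_\ast)\cap\Delta(X)$. -}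

module Defs where

open import Algebra.Bundles using (Monoid)
open import Algebra.Core using (Op₂)
open import Data.Fin.Base using (Fin)
open import Data.Product.Base using (_×_; _,_; ∃-syntax)
open import Function.Bundles using (_↔_)
open import Level using (Level)
open import Relation.Binary.Core using (Rel)
open import Relation.Binary.PropositionalEquality using (_≡_; refl; sym; trans; cong₂)
open import Relation.Unary using (Pred; _∩_; U)

private
  variable
    a b ℓ : Level

Finite : Set a → Set a
Finite X = ∃[ n ] X ↔ Fin n

Regular : (M : Monoid a ℓ) → Monoid.Carrier M → Set _
Regular M x = ∃[ y ] (x ∙ y) ∙ x ≈ x
  where open Monoid M

module _ {X : Set a} where

  infixl 7 _▷_

  _▷_ : Op₂ (Op₂ X)
  (_∘_ ▷ _∗_) x y = (x ∘ y) ∗ (y ∘ x)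

  -- Equality of operations is extensional, since _≡_ on functions is not
  -- provably so.
  infix 4 _≈ᵒ_

  _≈ᵒ_ : Rel (Op₂ X) a
  _∘_ ≈ᵒ _∗_ = ∀ x y → (x ∘ y) ≡ (x ∗ y)

𝓜 : (X : Set a) → Monoid a a
𝓜 X = record
  { Carrier  = Op₂ X
  ; _≈_      = _≈ᵒ_
  ; _∙_      = _▷_
  ; ε        = λ x y → x
  ; isMonoid = record
    { isSemigroup = record
      { isMagma = record
        { isEquivalence = record
          { refl  = λ x y → refl
          ; sym   = λ p x y → sym (p x y)
          ; trans = λ p q x y → trans (p x y) (q x y)
          }
        ; ∙-cong = λ {_} {_∘′_} {_∗_} p q x y →
            trans (cong₂ _∗_ (p x y) (p y x)) (q (x ∘′ y) (y ∘′ x))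
        }
      ; assoc = λ _ _ _ x y → refl
      }
    ; identity = (λ _ x y → refl) , (λ _ x y → refl)
    }
  }

image : {A : Set a} {B : Set b} → (A → B) → Pred A ℓ → Pred B _
image f P y = ∃[ x ] P x × f x ≡ y

module _ {X : Set a} where

  Δ : Pred (X × X) a
  Δ p = ∃[ x ] p ≡ (x , x)

  T : Op₂ X → X × X → X × X
  T _∗_ (x , y) = (x ∗ y) , (y ∗ x)

  im diag cim : (X × X → X × X) → Pred (X × X) a
  im   t = image t U
  diag t = image t Δ
  cim  t = im t ∩ Δ

{-# OPTIONS --safe #-}

-- Since T (∗ ▷ ∘) = T ∘ after T ∗, the operation ∗ is regular iff T ∗ has a
-- generalised inverse of the form T ∘, i.e. one commuting with the swap of
-- coordinates. Such a map preserves Δ, so it provides diagonal preimages for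
-- the diagonal points of the image. Conversely, any choice of preimages which
-- is diagonal on Δ can be made to commute with the swap: keep it on the pairs
-- (u , v) with u ≤ v, for a total order on X, and transport it to the others.
module Submission where

open import Algebra.Core using (Op₂)
open import Data.Fin.Base using (_≤_)
open import Data.Fin.Properties using (any?; inj⇒≟; *↔×; ≤-antisym; ≤-total; _≤?_)
open import Data.Nat.Base using (_*_)
open import Data.Product.Base using (_×_; _,_; ∃; ∃-syntax; proj₁; proj₂; swap)
open import Data.Product.Function.NonDependent.Propositional using (_×-↔_)
open import Data.Product.Properties using (≡-dec)
open import Data.Sum.Base using (inj₁; inj₂)
open import Data.Unit.Base using (tt)
open import Function.Base using (_∘_; _on_)
open import Function.Bundles using (_⇔_; mk⇔; module Injection; module Inverse)
open import Function.Construct.Composition using (_↔-∘_)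
open import Function.Properties.Inverse using (↔-sym; ↔⇒↣)
open import Level using (Level)
open import Relation.Binary.Definitions using (Antisymmetric; DecidableEquality; Total)
  renaming (Decidable to Decidable₂)
open import Relation.Binary.PropositionalEquality using (_≡_; refl; sym; cong; subst)
open import Relation.Nullary.Decidable using (Dec; yes; no; map′; _×-dec_)
open import Relation.Nullary.Negation using (contradiction)
open import Relation.Unary using (Pred; Decidable; U; _∈_; _⊆_; _≐_)
open import Relation.Unary.Properties using (U?)
open import Defs

private
  variable
    a b ℓ : Level
    A : Set a
    B : Set b

finite-× : Finite A → Finite B → Finite (A × B)
finite-× (m , A↔m) (n , B↔n) = m * n , ↔-sym *↔× ↔-∘ (A↔m ×-↔ B↔n)

finite⇒≟ : Finite A → DecidableEquality A
finite⇒≟ (_ , A↔n) = inj⇒≟ (↔⇒↣ A↔n)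

finite⇒∃? : Finite A → {P : Pred A ℓ} → Decidable P → Dec (∃ P)
finite⇒∃? (_ , A↔n) {P} P? =
  map′ (λ (i , p) → from i , p)
       (λ (x , p) → to x , subst P (sym (strictlyInverseʳ x)) p)
       (any? (P? ∘ from))
  where open Inverse A↔n

image? : Finite A → DecidableEquality B → (f : A → B) {P : Pred A ℓ} →
         Decidable P → Decidable (image f P)
image? finA _≟_ f P? y = finite⇒∃? finA λ x → P? x ×-dec (f x ≟ y)

Δ? : DecidableEquality A → Decidable (Δ {X = A})
Δ? _≟_ (x , y) = map′ (λ { refl → x , refl }) (λ { (_ , refl) → refl }) (x ≟ y)

module _ {X : Set a} (_∗_ : Op₂ X) where

  diag⊆cim : diag (T _∗_) ⊆ cim (T _∗_)
  diag⊆cim (_ , (x , refl) , refl) = ((x , x) , tt , refl) , (x ∗ x , refl)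

  -- If `T _∗_` sends `(x , y)` to `(c , c)`, regularity at `x`, `y` says that `c ∘′ c` is a square
  -- root of `c` under `_∗_`.
  regular⇒cim⊆diag : Regular (𝓜 X) _∗_ → cim (T _∗_) ⊆ diag (T _∗_)
  regular⇒cim⊆diag (_∘′_ , reg) (((x , y) , _ , eq) , (c , refl)) =
    (c ∘′ c , c ∘′ c) , (c ∘′ c , refl) , cong (λ z → z , z) c-fixed
    where
    c-fixed : (c ∘′ c) ∗ (c ∘′ c) ≡ c
    c-fixed = subst (λ (u , v) → (u ∘′ v) ∗ (v ∘′ u) ≡ u) eq (reg x y)

  -- Both clauses are conditional, so that a choice of `q` can be total in `p`, including points
  -- outside the image.
  IsPreimage : X × X → X × X → Set a
  IsPreimage p q = (p ∈ im (T _∗_) → T _∗_ q ≡ p) × (p ∈ Δ → q ∈ Δ)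

  preimage : Finite X → cim (T _∗_) ⊆ diag (T _∗_) → ∀ p → ∃[ q ] IsPreimage p q
  preimage finX cim⊆diag p
    with image? finX² _≟²_ (T _∗_) (Δ? _≟_) p | image? finX² _≟²_ (T _∗_) U? p
    where
    finX² = finite-× finX finX
    _≟_   = finite⇒≟ finX
    _≟²_  = ≡-dec _≟_ _≟_
  ... | yes (q , q∈Δ , Tq≡p) | _                  = q , (λ _ → Tq≡p) , (λ _ → q∈Δ)
  -- Diagonal preimages were tried first, so by `cim⊆diag` this `p` lies off the diagonal.
  ... | no p∉diag            | yes (q , _ , Tq≡p) =
    q , (λ _ → Tq≡p) , λ p∈Δ → contradiction (cim⊆diag ((q , tt , Tq≡p) , p∈Δ)) p∉diag
  -- An arbitrary value, except that it must be diagonal whenever `p` is.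
  ... | no _                 | no p∉im            =
    p , (λ p∈im → contradiction p∈im p∉im) , (λ p∈Δ → p∈Δ)

  module _ {_≼_ : X → X → Set ℓ} (_≼?_ : Decidable₂ _≼_)
           (≼-antisym : Antisymmetric _≡_ _≼_) (≼-total : Total _≼_)
           (pre : ∀ p → ∃[ q ] IsPreimage p q) where

    inverse : Op₂ X
    inverse u v with u ≼? v
    ... | yes _ = proj₁ (proj₁ (pre (u , v)))
    ... | no  _ = proj₂ (proj₁ (pre (v , u)))

    im-swap : ∀ {p} → p ∈ im (T _∗_) → swap p ∈ im (T _∗_)
    im-swap (q , _ , eq) = swap q , tt , cong swap eq

    -- For `u` and `v` distinct, the two operands are the coordinates of one chosen preimage, of
    -- `(u , v)` or, in reverse order, of `(v , u)`.
    inverse-section : ∀ u v → (u , v) ∈ im (T _∗_) → inverse u v ∗ inverse v u ≡ u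
    inverse-section u v uv∈im with u ≼? v | v ≼? u
    ... | yes u≼v | yes v≼u with refl ← ≼-antisym u≼v v≼u
                            with pre (u , u)
    -- Both operands are now the first coordinate of `q`; they make up `q` itself because `q` is
    -- diagonal.
    ...   | q , T-q , q-Δ   with (d , refl) ← q-Δ (u , refl) = cong proj₁ (T-q uv∈im)
    inverse-section u v uv∈im | yes _ | no _ with pre (u , v)
    ...   | _ , T-q , _ = cong proj₁ (T-q uv∈im)
    inverse-section u v uv∈im | no _ | yes _ with pre (v , u)
    ...   | _ , T-q , _ = cong proj₂ (T-q (im-swap uv∈im))
    inverse-section u v uv∈im | no u⋠v | no v⋠u with ≼-total u v
    ...   | inj₁ u≼v = contradiction u≼v u⋠v
    ...   | inj₂ v≼u = contradiction v≼u v⋠u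

    preimage⇒regular : Regular (𝓜 X) _∗_
    preimage⇒regular = inverse , λ x y →
      inverse-section (x ∗ y) (y ∗ x) ((x , y) , tt , refl)

  cim⊆diag⇒regular : Finite X → cim (T _∗_) ⊆ diag (T _∗_) → Regular (𝓜 X) _∗_
  cim⊆diag⇒regular finX@(_ , X↔n) cim⊆diag =
    -- The order of `Fin n` is pulled back along the bijection; injectivity carries antisymmetry
    -- over to `X`.
    preimage⇒regular {_≼_ = _≤_ on to}
      (λ x y → to x ≤? to y)
      (λ x≼y y≼x → injective (≤-antisym x≼y y≼x))
      (λ x y → ≤-total (to x) (to y))
      (preimage finX cim⊆diag)
    where open Injection (↔⇒↣ X↔n) using (to; injective)

proposition24 : ∀ {a} {X : Set a} → Finite X → (_∗_ : Op₂ X) →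
    Regular (𝓜 X) _∗_ ⇔ (cim (T _∗_) ≐ diag (T _∗_))
proposition24 finX _∗_ = mk⇔ regular⇒cim≐diag cim≐diag⇒regular
  where
  regular⇒cim≐diag : Regular (𝓜 _) _∗_ → cim (T _∗_) ≐ diag (T _∗_)
  regular⇒cim≐diag reg = regular⇒cim⊆diag _∗_ reg , diag⊆cim _∗_

  cim≐diag⇒regular : cim (T _∗_) ≐ diag (T _∗_) → Regular (𝓜 _) _∗_
  cim≐diag⇒regular (cim⊆diag , _) = cim⊆diag⇒regular _∗_ finX cim⊆diag
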